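{- For every integer $n\ge 1$, $$\mathrm{pf}_n(132,213)=\mathrm{pf}_n(132,312)=\mathrm{pf}_n(213,231)=\mathrm{pf}_n(231,312).$$ Furthermore, with the convention $\mathrm{pf}_0(132,213)=1$, for every integer $n\ge 1$, $$\mathrm{pf}_n(132,213)=\mathrm{pf}_{n-1}(132,213)+2\sum_{i=1}^{n-1}\mathrm{pf}_i(132,213)\,\mathrm{pf}_{n-i-1}(132,213).$$
   Context: A Dyck path of semilength $n$ is a lattice path from $(0,0)$ to $(n,n)$ consisting of $n$ north steps $N=(0,1)$ and $n$ east steps $E=(1,0)$ that never goes below the line $y=x$. A parking function of size $n$ is a Dyck path of semilength $n$ whose $n$ north steps are labeled bijectively by $\{1,\dots,n\}$ so that whenever two north steps are consecutive in the path (one immediately following the other), the label of the later one is larger. For a parking function $p$ of size $n$, $\phi(p)$ is the permutation of $\{1,\dots,n\}$ (in one-line notation) obtained by reading the labels of the north steps in the order they occur along the path. A permutation $\pi$ of $\{1,\dots,n\}$ contains a permutation $\rho$ of $\{1,\dots,m\}$ if there are indices $1\le i_1<\cdots<i_m\le n$ such that $\pi_{i_a}\le\pi_{i_b}$ if and only if $\rho_a\le\rho_b$; otherwise $\pi$ avoids $\rho$. For permutations $\rho_1,\dots,\rho_r$, $\mathrm{pf}_n(\rho_1,\dots,\rho_r)$ denotes the number of parking functions $p$ of size $n$ such that $\phi(p)$ avoids each of $\rho_1,\dots,\rho_r$. -}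

module Defs where

open import Data.Nat.Base using (ℕ; zero; suc; _+_; _≤_)
open import Data.Nat.ListAction using (sum)
import Data.Nat.Properties as ℕ
open import Data.Fin.Base as Fin using (Fin; toℕ)
import Data.Fin.Properties as Fin
open import Data.List.Base as List
  using (List; []; _∷_; [_]; map; mapMaybe; filter; length; inits; allFin
        ; applyUpTo; cartesianProductWith)
open import Data.List.Membership.Propositional using (_∈_)
open import Data.List.Membership.Propositional.Properties
  using (∈-cartesianProductWith⁺; ∈-filter⁺; ∈-filter⁻; ∈-map⁺; ∈-map⁻; ∈-allFin)
open import Data.List.Properties using (∷-injective; length-map)
open import Data.List.Relation.Unary.All using (All; all?; [])
open import Data.List.Relation.Unary.All.Properties using (¬Any⇒All¬)
open import Data.List.Relation.Unary.AllPairs using ([]; _∷_)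
open import Data.List.Relation.Unary.Any using (here; there)
open import Data.List.Relation.Unary.Linked using (Linked; linked?)
open import Data.List.Relation.Unary.Unique.Propositional using (Unique)
import Data.List.Relation.Unary.Unique.Propositional.Properties as Unique
open import Data.Maybe.Base using (Maybe; just; nothing)
open import Data.Product.Base using (∃-syntax; _×_; _,_; proj₁; proj₂)
open import Data.Unit.Base using (⊤)
open import Data.Vec.Base as Vec using (Vec; []; _∷_)
open import Function.Base using (_∘_)
open import Function.Bundles using (_⇔_; mk⇔; Equivalence)
open import Function.Definitions using (Bijective)
open import Relation.Binary.Definitions using (DecidableEquality)
import Relation.Binary.Definitions as Binary
open import Relation.Binary.PropositionalEquality
  using (_≡_; refl; sym; trans; cong; cong₂; subst)
open import Relation.Nullary.Decidable
  using (Dec; yes; no; map′; _×-dec_; _→-dec_; ¬?)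
open import Relation.Nullary.Negation using (¬_)
open import Relation.Unary using (Decidable)

data Step : Set where
  N E : Step

_≟_ : DecidableEquality Step
N ≟ N = yes refl
N ≟ E = no λ ()
E ≟ N = no λ ()
E ≟ E = yes refl

#_ : Step → List Step → ℕ
(# s) w = length (filter (_≟ s) w)

-- A prefix w ends at the lattice point (# E w , # N w).
WeaklyAbove : List Step → Set
WeaklyAbove w = (# E) w ≤ (# N) w

record IsDyckPath (n : ℕ) (w : List Step) : Set where
  field
    norths     : (# N) w ≡ n
    easts      : (# E) w ≡ n
    neverBelow : All WeaklyAbove (inits w)

isDyckPath? : ∀ n → Decidable (IsDyckPath n)
isDyckPath? n w = map′
  (λ (p , q , r) → record { norths = p ; easts = q ; neverBelow = r })
  (λ d → let open IsDyckPath d in norths , easts , neverBelow)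
  (((# N) w ℕ.≟ n) ×-dec ((# E) w ℕ.≟ n)
    ×-dec all? (λ v → (# E) v ℕ.≤? (# N) v) (inits w))

-- The label k + 1 ∈ {1, …, n} is represented by k : Fin n.
data LStep (n : ℕ) : Set where
  N : Fin n → LStep n
  E : LStep n

step : ∀ {n} → LStep n → Step
step (N _) = N
step E     = E

label : ∀ {n} → LStep n → Maybe (Fin n)
label (N a) = just a
label E     = nothing

labels : ∀ {n} → List (LStep n) → List (Fin n)
labels = mapMaybe label

Ascending : ∀ {n} → LStep n → LStep n → Set
Ascending (N a) (N b) = a Fin.< b
Ascending (N _) E     = ⊤
Ascending E     _     = ⊤

ascending? : ∀ {n} → Binary.Decidable (Ascending {n})
ascending? (N a) (N b) = a Fin.<? b
ascending? (N _) E     = yes _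
ascending? E     _     = yes _

record IsParkingFunction (n : ℕ) (p : List (LStep n)) : Set where
  field
    dyck      : IsDyckPath n (map step p)
    bijective : Bijective _≡_ _≡_ (List.lookup (labels p))
    ascending : Linked Ascending p

bijective? : ∀ {m n} (f : Fin m → Fin n) → Dec (Bijective _≡_ _≡_ f)
bijective? f = map′
  (λ (i , s) → (λ {x} {y} → i x y) , λ y → proj₁ (s y) , λ { refl → proj₂ (s y) })
  (λ (i , s) → (λ x y → i {x} {y}) , λ y → proj₁ (s y) , proj₂ (s y) refl)
  (Fin.all? (λ x → Fin.all? λ y → (f x Fin.≟ f y) →-dec (x Fin.≟ y))
    ×-dec Fin.all? (λ y → Fin.any? λ x → f x Fin.≟ y))

isParkingFunction? : ∀ n → Decidable (IsParkingFunction n)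
isParkingFunction? n p = map′
  (λ (d , b , a) → record { dyck = d ; bijective = b ; ascending = a })
  (λ q → let open IsParkingFunction q in dyck , bijective , ascending)
  (isDyckPath? n (map step p)
    ×-dec bijective? (List.lookup (labels p))
    ×-dec linked? ascending? p)

-- One-line notation with values in {1, …, n}.
φ : ∀ {n} → List (LStep n) → List ℕ
φ = map (suc ∘ toℕ) ∘ labels

record IsOccurrence (π ρ : List ℕ) (i : Vec (Fin (length π)) (length ρ)) : Set where
  field
    increasing : ∀ a b → a Fin.< b → Vec.lookup i a Fin.< Vec.lookup i b
    sameOrder  : ∀ a b →
      List.lookup π (Vec.lookup i a) ≤ List.lookup π (Vec.lookup i b) ⇔
      List.lookup ρ a ≤ List.lookup ρ b

_Contains_ : List ℕ → List ℕ → Set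
π Contains ρ = ∃[ i ] IsOccurrence π ρ i

_Avoids_ : List ℕ → List ℕ → Set
π Avoids ρ = ¬ (π Contains ρ)

isOccurrence? : ∀ π ρ → Decidable (IsOccurrence π ρ)
isOccurrence? π ρ i = map′
  (λ (m , s) → record { increasing = m
                      ; sameOrder  = λ a b → mk⇔ (proj₁ (s a b)) (proj₂ (s a b)) })
  (λ o → let open IsOccurrence o in
     increasing ,
     λ a b → Equivalence.to (sameOrder a b) , Equivalence.from (sameOrder a b))
  (Fin.all? (λ a → Fin.all? λ b →
      (a Fin.<? b) →-dec (Vec.lookup i a Fin.<? Vec.lookup i b))
    ×-dec Fin.all? (λ a → Fin.all? λ b →
      let π≤? = List.lookup π (Vec.lookup i a) ℕ.≤? List.lookup π (Vec.lookup i b)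
          ρ≤? = List.lookup ρ a ℕ.≤? List.lookup ρ b
      in (π≤? →-dec ρ≤?) ×-dec (ρ≤? →-dec π≤?)))

anyVec? : ∀ {n} m {P : Vec (Fin n) m → Set} → Decidable P → Dec (∃[ i ] P i)
anyVec? zero    P? = map′ ([] ,_) (λ { ([] , p) → p }) (P? [])
anyVec? (suc m) P? = map′
  (λ (x , i , p) → x ∷ i , p)
  (λ { (x ∷ i , p) → x , i , p })
  (Fin.any? λ x → anyVec? m (P? ∘ (x ∷_)))

_contains?_ : Binary.Decidable _Contains_
π contains? ρ = anyVec? (length ρ) (isOccurrence? π ρ)

AvoidsAll : List (List ℕ) → List ℕ → Set
AvoidsAll ρs π = All (π Avoids_) ρs

avoidsAll? : ∀ ρs → Decidable (AvoidsAll ρs)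
avoidsAll? ρs π = all? (λ ρ → ¬? (π contains? ρ)) ρs

words : ∀ {A : Set} → List A → ℕ → List (List A)
words xs zero    = [ [] ]
words xs (suc k) = cartesianProductWith _∷_ xs (words xs k)

lsteps : ∀ n → List (LStep n)
lsteps n = E ∷ map N (allFin n)

parkingFunctions : ∀ n → List (List (LStep n))
parkingFunctions n = filter (isParkingFunction? n) (words (lsteps n) (n + n))

pf : ℕ → List (List ℕ) → ℕ
pf n ρs = length (filter (avoidsAll? ρs ∘ φ) (parkingFunctions n))

-- parkingFunctions n lists every parking function of size n exactly once,
-- so pf does count them.

∈-words : ∀ {A : Set} {xs : List A} → (∀ x → x ∈ xs) → ∀ w → w ∈ words xs (length w)
∈-words all∈ []      = here refl
∈-words all∈ (x ∷ w) = ∈-cartesianProductWith⁺ _∷_ (all∈ x) (∈-words all∈ w)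

words-unique : ∀ {A : Set} {xs : List A} → Unique xs → ∀ k → Unique (words xs k)
words-unique xs! zero    = [] ∷ []
words-unique xs! (suc k) =
  Unique.cartesianProductWith⁺ _∷_ ∷-injective xs! (words-unique xs! k)

∈-lsteps : ∀ {n} (s : LStep n) → s ∈ lsteps n
∈-lsteps (N a) = there (∈-map⁺ N (∈-allFin a))
∈-lsteps E     = here refl

lsteps-unique : ∀ n → Unique (lsteps n)
lsteps-unique n =
  ¬Any⇒All¬ _ (absurd ∘ ∈-map⁻ N)
  ∷ Unique.map⁺ (λ { refl → refl }) (Unique.allFin⁺ n)
  where
  absurd : ¬ (∃[ a ] (a ∈ allFin n × E ≡ N a))
  absurd (_ , _ , ())

length-#N+#E : ∀ w → length w ≡ (# N) w + (# E) w
length-#N+#E []      = refl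
length-#N+#E (N ∷ w) = cong suc (length-#N+#E w)
length-#N+#E (E ∷ w) =
  trans (cong suc (length-#N+#E w)) (sym (ℕ.+-suc ((# N) w) ((# E) w)))

parkingFunction-length : ∀ {n} p → IsParkingFunction n p → length p ≡ n + n
parkingFunction-length p q =
  trans (sym (length-map step p))
    (trans (length-#N+#E (map step p)) (cong₂ _+_ norths easts))
  where open IsDyckPath (IsParkingFunction.dyck q)

∈-parkingFunctions : ∀ {n} p → p ∈ parkingFunctions n ⇔ IsParkingFunction n p
∈-parkingFunctions {n} p = mk⇔
  (λ p∈ → proj₂ (∈-filter⁻ (isParkingFunction? n) {xs = words (lsteps n) (n + n)} p∈))
  (λ q → ∈-filter⁺ (isParkingFunction? n)
    (subst (λ k → p ∈ words (lsteps n) k) (parkingFunction-length p q)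
      (∈-words ∈-lsteps p)) q)

parkingFunctions-unique : ∀ n → Unique (parkingFunctions n)
parkingFunctions-unique n =
  Unique.filter⁺ (isParkingFunction? n) (words-unique (lsteps-unique n) (n + n))

p132 p213 p231 p312 : List ℕ
p132 = 1 ∷ 3 ∷ 2 ∷ []
p213 = 2 ∷ 1 ∷ 3 ∷ []
p231 = 2 ∷ 3 ∷ 1 ∷ []
p312 = 3 ∷ 1 ∷ 2 ∷ []

-- The convention for size 0 agrees with the count: the empty path is the
-- only parking function of size 0.
pf-zero : pf 0 (p132 ∷ p213 ∷ []) ≡ 1
pf-zero = refl

-- Σ₁ k f is f 1 + ⋯ + f k.
Σ₁ : ℕ → (ℕ → ℕ) → ℕ
Σ₁ k f = sum (map f (applyUpTo suc k))

{-# OPTIONS --safe #-}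

-- In a permutation avoiding one of the four pairs, the comparison of the first and
-- third of any three entries is a function of the two intermediate comparisons:
-- (x < z) = (x < y) ∙ (y < z), where ∙ is conjunction for {132, 213}, the second
-- projection for {132, 312}, the first projection for {213, 231} and disjunction for
-- {231, 312}. These operations are associative and idempotent, so for each ascent
-- pattern exactly one permutation satisfies this. An avoiding parking function is
-- therefore the same as a Dyck path in which every factor E N is marked as an ascent
-- or a descent (a factor N N is an ascent), and splitting such a path at its first
-- return to the diagonal gives the recurrence.
module Submission where

open import Defs
open import Algebra.Core using (Op₂)
open import Algebra.Structures using (IsBand)
open import Data.Bool.Base using (Bool; true; false; not; _∧_; _∨_)
open import Data.Bool.Properties as Bool
  using (¬-not; not-¬; ∧-identityʳ; ∧-zeroʳ; ∨-identityʳ; ∨-zeroʳ; ∧-isBand; ∨-isBand)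
open import Data.Empty using (⊥-elim)
open import Data.Fin.Base as Fin
  using (Fin; zero; suc; toℕ; fromℕ; inject₁; punchIn; punchOut)
open import Data.Fin.Induction using (<-weakInduction)
import Data.Fin.Properties as Fin
open import Data.List.Base
  using (List; []; _∷_; [_]; _++_; map; length; lookup; filter; inits; zip; applyUpTo)
open import Data.List.Membership.Propositional using (_∈_)
open import Data.List.Membership.Propositional.Properties
  using (∈-++⁺ˡ; ∈-++⁺ʳ; ∈-++⁻; ∈-map⁺; ∈-map⁻; ∈-lookup; ∈-filter⁺; ∈-filter⁻)
open import Data.List.Properties
  using (length-++; length-map; map-applyUpTo; map-cong; map-cong-local; map-∘; ∷-injective)
open import Data.List.Relation.Binary.Disjoint.Propositional using (Disjoint)
open import Data.List.Relation.Unary.All as All using (All; []; _∷_)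
import Data.List.Relation.Unary.All.Properties as All
open import Data.List.Relation.Unary.AllPairs as AllPairs using (AllPairs; []; _∷_)
import Data.List.Relation.Unary.AllPairs.Properties as AllPairs
open import Data.List.Relation.Unary.Any as Any using (here; there)
open import Data.List.Relation.Unary.Any.Properties using (lookup-index)
open import Data.List.Relation.Unary.Linked using (Linked; [-]; _∷_)
open import Data.List.Relation.Unary.Unique.Propositional using (Unique)
import Data.List.Relation.Unary.Unique.Propositional.Properties as Unique
open import Data.Nat.Base
  using (ℕ; zero; suc; _+_; _*_; _∸_; _≤_; _<_; _<ᵇ_; z≤n; s≤s; s≤s⁻¹; z<s; s<s)
open import Data.Nat.ListAction using (sum)
import Data.Nat.Properties as ℕ
open import Data.List.Relation.Unary.Unique.DecPropositional ℕ._≟_ using (unique?)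
open import Data.Nat.Solver using (module +-*-Solver)
open import Data.Product.Base using (∃-syntax; _×_; _,_; proj₁; proj₂)
open import Data.Sum.Base using (inj₁; inj₂; [_,_]′)
open import Data.Vec.Base as Vec using ([]; _∷_)
open import Function.Base using (_∘_)
open import Function.Bundles using (_⇔_; mk⇔; Equivalence)
open import Function.Definitions using (Bijective; Injective)
open import Relation.Binary.Definitions using (tri<; tri≈; tri>)
open import Relation.Binary.PropositionalEquality
  using (_≡_; _≢_; refl; sym; trans; cong; cong₂; subst; isEquivalence; module ≡-Reasoning)
open import Relation.Nullary.Decidable using (yes; no; from-yes)
open import Relation.Nullary.Negation using (¬_; contradiction)
open import Relation.Nullary.Reflects using (ofʸ; ofⁿ)

-- Counting by a one-to-one correspondence

module _ {A : Set} where

  allPairs⁺ : ∀ {R : A → A → Set} xs →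
              (∀ i j → i Fin.< j → R (lookup xs i) (lookup xs j)) → AllPairs R xs
  allPairs⁺ []       _ = []
  allPairs⁺ {R} (x ∷ xs) r =
    All.tabulate (λ x∈ → subst (R x) (sym (lookup-index x∈)) (r zero (suc (Any.index x∈)) z<s))
    ∷ allPairs⁺ xs (λ i j i<j → r (suc i) (suc j) (s<s i<j))

  allPairs⁻ : ∀ {R : A → A → Set} {xs} → AllPairs R xs →
              ∀ i j → i Fin.< j → R (lookup xs i) (lookup xs j)
  allPairs⁻ (r ∷ _)  zero    (suc j) _         = All.lookup r (∈-lookup j)
  allPairs⁻ (_ ∷ rs) (suc i) (suc j) (s<s i<j) = allPairs⁻ rs i j i<j

  lookup-injective : ∀ {xs : List A} → Unique xs → Injective _≡_ _≡_ (lookup xs)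
  lookup-injective xs! {i} {j} eq with Fin.<-cmp i j
  ... | tri< i<j _ _ = ⊥-elim (allPairs⁻ xs! i j i<j eq)
  ... | tri≈ _ i≡j _ = i≡j
  ... | tri> _ _ j<i = ⊥-elim (allPairs⁻ xs! j i j<i (sym eq))

  injective⇒unique : ∀ (xs : List A) → Injective _≡_ _≡_ (lookup xs) → Unique xs
  injective⇒unique xs inj = allPairs⁺ xs λ i j i<j eq → Fin.<⇒≢ i<j (inj eq)

-- Pigeonhole on positions. A relation instead of a function lets one encoding serve in both
-- directions: each inequality between two lists reads the same equation from a different side, so
-- no inverse function has to be defined.
length-≤ : ∀ {A B : Set} {xs : List A} {ys : List B} (R : A → B → Set) → Unique xs →
           (∀ {x} → x ∈ xs → ∃[ y ] (y ∈ ys × R x y)) →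
           (∀ {x x′ y} → x ∈ xs → x′ ∈ xs → R x y → R x′ y → x ≡ x′) →
           length xs ≤ length ys
length-≤ {xs = xs} {ys} R xs! total inj = Fin.injective⇒≤ {f = f} f-injective
  where
  image : ∀ i → ∃[ y ] (y ∈ ys × R (lookup xs i) y)
  image i = total (∈-lookup i)

  f : Fin (length xs) → Fin (length ys)
  f i = Any.index (proj₁ (proj₂ (image i)))

  related : ∀ i → R (lookup xs i) (lookup ys (f i))
  related i = let _ , y∈ , r = image i in subst (R _) (lookup-index y∈) r

  f-injective : Injective _≡_ _≡_ f
  f-injective {i} {j} eq = lookup-injective xs!
    (inj (∈-lookup i) (∈-lookup j) (related i)
      (subst (λ k → R (lookup xs j) (lookup ys k)) (sym eq) (related j)))

-- Marked Dyck paths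

-- Suffixes of a Dyck path that follow a step s, start h above the diagonal and
-- contain n north steps; the marks tell the ascents from the descents of the labels.
data Marked : Step → (h n : ℕ) → List Step → List Bool → Set where
  end  : ∀ {s} → Marked s 0 0 [] []
  east : ∀ {s h n w b} → Marked E h n w b → Marked s (suc h) n (E ∷ w) b
  rise : ∀ {s h n w b} → Marked N (suc h) n w b → Marked s h (suc n) (N ∷ w) (true ∷ b)
  fall : ∀ {h n w b} → Marked N (suc h) n w b → Marked E h (suc n) (N ∷ w) (false ∷ b)

MarkedWord : Set
MarkedWord = List Step × List Bool

east⁺ rise⁺ fall⁺ : MarkedWord → MarkedWord
east⁺ (w , b) = E ∷ w , b
rise⁺ (w , b) = N ∷ w , true ∷ b
fall⁺ (w , b) = N ∷ w , false ∷ b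

-- The recursion is lexicographic: a north step lowers `n` while raising `h`, and an east step keeps
-- `n` and lowers `h`.
markedWords : Step → ℕ → ℕ → List MarkedWord
markedWords s zero    zero    = [ [] , [] ]
markedWords s (suc h) zero    = map east⁺ (markedWords E h zero)
markedWords N zero    (suc n) = map rise⁺ (markedWords N 1 n)
markedWords E zero    (suc n) =
  map rise⁺ (markedWords N 1 n) ++ map fall⁺ (markedWords N 1 n)
markedWords N (suc h) (suc n) =
  map rise⁺ (markedWords N (2 + h) n) ++ map east⁺ (markedWords E h (suc n))
markedWords E (suc h) (suc n) =
  (map rise⁺ (markedWords N (2 + h) n) ++ map fall⁺ (markedWords N (2 + h) n))
  ++ map east⁺ (markedWords E h (suc n))

∈-markedWords⁺ : ∀ {s h n w b} → Marked s h n w b → (w , b) ∈ markedWords s h n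
∈-markedWords⁺ end = here refl
∈-markedWords⁺ {s} {suc h} {zero}  (east m) = ∈-map⁺ east⁺ (∈-markedWords⁺ m)
∈-markedWords⁺ {N} {suc h} {suc n} (east m) = ∈-++⁺ʳ _ (∈-map⁺ east⁺ (∈-markedWords⁺ m))
∈-markedWords⁺ {E} {suc h} {suc n} (east m) = ∈-++⁺ʳ _ (∈-map⁺ east⁺ (∈-markedWords⁺ m))
∈-markedWords⁺ {N} {zero}  (rise m) = ∈-map⁺ rise⁺ (∈-markedWords⁺ m)
∈-markedWords⁺ {E} {zero}  (rise m) = ∈-++⁺ˡ (∈-map⁺ rise⁺ (∈-markedWords⁺ m))
∈-markedWords⁺ {N} {suc h} (rise m) = ∈-++⁺ˡ (∈-map⁺ rise⁺ (∈-markedWords⁺ m))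
∈-markedWords⁺ {E} {suc h} (rise m) = ∈-++⁺ˡ (∈-++⁺ˡ (∈-map⁺ rise⁺ (∈-markedWords⁺ m)))
∈-markedWords⁺ {E} {zero}  (fall m) = ∈-++⁺ʳ _ (∈-map⁺ fall⁺ (∈-markedWords⁺ m))
∈-markedWords⁺ {E} {suc h} {suc n} (fall m) =
  ∈-++⁺ˡ (∈-++⁺ʳ (map rise⁺ (markedWords N (2 + h) n)) (∈-map⁺ fall⁺ (∈-markedWords⁺ m)))

∈-markedWords⁻ : ∀ s h n {w b} → (w , b) ∈ markedWords s h n → Marked s h n w b
∈-markedWords⁻ s zero zero (here refl) = end
∈-markedWords⁻ s (suc h) zero x∈ with ∈-map⁻ east⁺ x∈
... | _ , y∈ , refl = east (∈-markedWords⁻ E h zero y∈)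
∈-markedWords⁻ N zero (suc n) x∈ with ∈-map⁻ rise⁺ x∈
... | _ , y∈ , refl = rise (∈-markedWords⁻ N 1 n y∈)
∈-markedWords⁻ E zero (suc n) x∈ with ∈-++⁻ (map rise⁺ (markedWords N 1 n)) x∈
... | inj₁ x∈₁ with _ , y∈ , refl ← ∈-map⁻ rise⁺ x∈₁ = rise (∈-markedWords⁻ N 1 n y∈)
... | inj₂ x∈₂ with _ , y∈ , refl ← ∈-map⁻ fall⁺ x∈₂ = fall (∈-markedWords⁻ N 1 n y∈)
∈-markedWords⁻ N (suc h) (suc n) x∈ with ∈-++⁻ (map rise⁺ (markedWords N (2 + h) n)) x∈
... | inj₁ x∈₁ with _ , y∈ , refl ← ∈-map⁻ rise⁺ x∈₁ = rise (∈-markedWords⁻ N (2 + h) n y∈)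
... | inj₂ x∈₂ with _ , y∈ , refl ← ∈-map⁻ east⁺ x∈₂ = east (∈-markedWords⁻ E h (suc n) y∈)
∈-markedWords⁻ E (suc h) (suc n) x∈
  with ∈-++⁻ (map rise⁺ (markedWords N (2 + h) n) ++ map fall⁺ (markedWords N (2 + h) n)) x∈
... | inj₂ x∈₂ with _ , y∈ , refl ← ∈-map⁻ east⁺ x∈₂ = east (∈-markedWords⁻ E h (suc n) y∈)
... | inj₁ x∈₁ with ∈-++⁻ (map rise⁺ (markedWords N (2 + h) n)) x∈₁
...   | inj₁ x∈₃ with _ , y∈ , refl ← ∈-map⁻ rise⁺ x∈₃ = rise (∈-markedWords⁻ N (2 + h) n y∈)
...   | inj₂ x∈₃ with _ , y∈ , refl ← ∈-map⁻ fall⁺ x∈₃ = fall (∈-markedWords⁻ N (2 + h) n y∈)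

map-disjoint : ∀ {A B : Set} {f g : A → B} {xs ys} → (∀ {x y} → f x ≢ g y) →
               Disjoint (map f xs) (map g ys)
map-disjoint f≢g (v∈ , v∈′) with _ , _ , refl ← ∈-map⁻ _ v∈ | _ , _ , eq ← ∈-map⁻ _ v∈′ = f≢g eq

markedWords-unique : ∀ s h n → Unique (markedWords s h n)
markedWords-unique = go
  where
  east! : ∀ {xs} → Unique xs → Unique (map east⁺ xs)
  east! = Unique.map⁺ λ { refl → refl }

  rise! : ∀ {xs} → Unique xs → Unique (map rise⁺ xs)
  rise! = Unique.map⁺ λ { refl → refl }

  rise-fall! : ∀ {xs} → Unique xs → Unique (map rise⁺ xs ++ map fall⁺ xs)
  rise-fall! xs! =
    Unique.++⁺ (rise! xs!) (Unique.map⁺ (λ { refl → refl }) xs!) (map-disjoint λ ())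

  go : ∀ s h n → Unique (markedWords s h n)
  go s zero    zero    = [] ∷ []
  go s (suc h) zero    = east! (go E h zero)
  go N zero    (suc n) = rise! (go N 1 n)
  go E zero    (suc n) = rise-fall! (go N 1 n)
  go N (suc h) (suc n) =
    Unique.++⁺ (rise! (go N (2 + h) n)) (east! (go E h (suc n))) (map-disjoint λ ())
  go E (suc h) (suc n) =
    Unique.++⁺ (rise-fall! (go N (2 + h) n)) (east! (go E h (suc n)))
      λ (v∈ , v∈′) → [ (λ v∈₁ → map-disjoint (λ ()) (v∈₁ , v∈′))
                     , (λ v∈₂ → map-disjoint (λ ()) (v∈₂ , v∈′))
                     ]′ (∈-++⁻ (map rise⁺ (markedWords N (2 + h) n)) v∈)

-- Convolution

infixl 7 _⋆_

-- The Cauchy product of sequences, that is, multiplication of generating functions.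
_⋆_ : (ℕ → ℕ) → (ℕ → ℕ) → ℕ → ℕ
(f ⋆ g) zero    = f 0 * g 0
(f ⋆ g) (suc n) = f 0 * g (suc n) + (f ∘ suc ⋆ g) n

-- The bounds `i ≤ n` allow rewriting inside a strong induction, where the equalities are known only
-- up to `n`.
⋆-cong : ∀ {f f′ g g′} n → (∀ i → i ≤ n → f i ≡ f′ i) → (∀ i → i ≤ n → g i ≡ g′ i) →
         (f ⋆ g) n ≡ (f′ ⋆ g′) n
⋆-cong zero    f≈ g≈ = cong₂ _*_ (f≈ 0 z≤n) (g≈ 0 z≤n)
⋆-cong (suc n) f≈ g≈ = cong₂ _+_
  (cong₂ _*_ (f≈ 0 z≤n) (g≈ (suc n) ℕ.≤-refl))
  (⋆-cong n (λ i i≤n → f≈ (suc i) (s≤s i≤n)) (λ i i≤n → g≈ i (ℕ.m≤n⇒m≤1+n i≤n)))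

⋆-*ˡ : ∀ c f g n → ((λ i → c * f i) ⋆ g) n ≡ c * (f ⋆ g) n
⋆-*ˡ c f g zero    = ℕ.*-assoc c (f 0) (g 0)
⋆-*ˡ c f g (suc n) = trans
  (cong₂ _+_ (ℕ.*-assoc c (f 0) (g (suc n))) (⋆-*ˡ c (f ∘ suc) g n))
  (sym (ℕ.*-distribˡ-+ c _ _))

⋆-*ʳ : ∀ c f g n → (f ⋆ (λ i → c * g i)) n ≡ c * (f ⋆ g) n
⋆-*ʳ c f g zero    = solve 3 (λ c x y → x :* (c :* y) := c :* (x :* y)) refl c (f 0) (g 0)
  where open +-*-Solver
⋆-*ʳ c f g (suc n) = trans (cong (f 0 * (c * g (suc n)) +_) (⋆-*ʳ c (f ∘ suc) g n))
  (solve 4 (λ c x y z → x :* (c :* y) :+ c :* z := c :* (x :* y :+ z)) refl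
    c (f 0) (g (suc n)) ((f ∘ suc ⋆ g) n))
  where open +-*-Solver

⋆-distribʳ : ∀ f f′ g n → ((λ i → f i + f′ i) ⋆ g) n ≡ (f ⋆ g) n + (f′ ⋆ g) n
⋆-distribʳ f f′ g zero    = ℕ.*-distribʳ-+ (g 0) (f 0) (f′ 0)
⋆-distribʳ f f′ g (suc n) = trans
  (cong ((f 0 + f′ 0) * g (suc n) +_) (⋆-distribʳ (f ∘ suc) (f′ ∘ suc) g n))
  (solve 5 (λ x y z u v → (x :+ y) :* z :+ (u :+ v) := x :* z :+ u :+ (y :* z :+ v)) refl
    (f 0) (f′ 0) (g (suc n)) ((f ∘ suc ⋆ g) n) ((f′ ∘ suc ⋆ g) n))
  where open +-*-Solver

⋆-assoc : ∀ f g h n → (f ⋆ g ⋆ h) n ≡ (f ⋆ (g ⋆ h)) n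
⋆-assoc f g h zero    = ℕ.*-assoc (f 0) (g 0) (h 0)
⋆-assoc f g h (suc n) = begin
  f 0 * g 0 * h (suc n) + ((λ i → f 0 * g (suc i) + (f ∘ suc ⋆ g) i) ⋆ h) n
    ≡⟨ cong (f 0 * g 0 * h (suc n) +_) (⋆-distribʳ (λ i → f 0 * g (suc i)) (f ∘ suc ⋆ g) h n) ⟩
  f 0 * g 0 * h (suc n) + (((λ i → f 0 * g (suc i)) ⋆ h) n + (f ∘ suc ⋆ g ⋆ h) n)
    ≡⟨ cong (λ x → f 0 * g 0 * h (suc n) + (x + (f ∘ suc ⋆ g ⋆ h) n)) (⋆-*ˡ (f 0) (g ∘ suc) h n) ⟩
  f 0 * g 0 * h (suc n) + (f 0 * (g ∘ suc ⋆ h) n + (f ∘ suc ⋆ g ⋆ h) n)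
    ≡⟨ cong (λ x → f 0 * g 0 * h (suc n) + (f 0 * (g ∘ suc ⋆ h) n + x)) (⋆-assoc (f ∘ suc) g h n) ⟩
  f 0 * g 0 * h (suc n) + (f 0 * (g ∘ suc ⋆ h) n + (f ∘ suc ⋆ (g ⋆ h)) n)
    ≡⟨ solve 5 (λ x y z u v → x :* y :* z :+ (x :* u :+ v) := x :* (y :* z :+ u) :+ v) refl
         (f 0) (g 0) (h (suc n)) ((g ∘ suc ⋆ h) n) ((f ∘ suc ⋆ (g ⋆ h)) n) ⟩
  (f ⋆ (g ⋆ h)) (suc n) ∎
  where
  open ≡-Reasoning
  open +-*-Solver

-- The definition splits off the term with `f 0`; this splits off the term with `g 0`, which in
-- `first-return` is the path that goes east at once.
⋆-sucʳ : ∀ f g n → (f ⋆ g) (suc n) ≡ (f ⋆ g ∘ suc) n + f (suc n) * g 0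
⋆-sucʳ f g zero    = refl
⋆-sucʳ f g (suc n) = trans (cong (f 0 * g (2 + n) +_) (⋆-sucʳ (f ∘ suc) g n))
  (sym (ℕ.+-assoc (f 0 * g (2 + n)) _ _))

⋆-sum : ∀ f g n → (f ⋆ g) n ≡ sum (applyUpTo (λ i → f i * g (n ∸ i)) (suc n))
⋆-sum f g zero    = sym (ℕ.+-identityʳ _)
⋆-sum f g (suc n) = cong (f 0 * g (suc n) +_) (⋆-sum (f ∘ suc) g n)

-- The recurrence

count : Step → ℕ → ℕ → ℕ
count s h n = length (markedWords s h n)

-- The little Schröder numbers 1, 1, 3, 11, 45, .... Starting as if after a north step forces the
-- first mark to be an ascent, so the first label, which has no predecessor, brings no choice.
schröder : ℕ → ℕ
schröder = count N 0

count-N-zero : ∀ n → schröder (suc n) ≡ count N 1 n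
count-N-zero n = length-map rise⁺ (markedWords N 1 n)

-- After an east step the next north step may carry either mark. There must be such a step: for size
-- 0 both counts are 1.
count-E-zero : ∀ n → count E 0 (suc n) ≡ 2 * schröder (suc n)
count-E-zero n = begin
  count E 0 (suc n)
    ≡⟨ length-++ (map rise⁺ (markedWords N 1 n)) ⟩
  length (map rise⁺ (markedWords N 1 n)) + length (map fall⁺ (markedWords N 1 n))
    ≡⟨ cong (schröder (suc n) +_) (length-map fall⁺ (markedWords N 1 n)) ⟩
  schröder (suc n) + count N 1 n
    ≡⟨ cong (schröder (suc n) +_) (trans (sym (count-N-zero n)) (sym (ℕ.+-identityʳ _))) ⟩
  2 * schröder (suc n) ∎
  where open ≡-Reasoning

count-suc-zero : ∀ s h → count s (suc h) 0 ≡ count E h 0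
count-suc-zero s h = length-map east⁺ (markedWords E h 0)

count-N-suc : ∀ h n → count N (suc h) (suc n) ≡ count N (2 + h) n + count E h (suc n)
count-N-suc h n = trans (length-++ (map rise⁺ (markedWords N (2 + h) n)))
  (cong₂ _+_ (length-map rise⁺ (markedWords N (2 + h) n))
             (length-map east⁺ (markedWords E h (suc n))))

count-E-suc : ∀ h n → count E (suc h) (suc n) ≡ 2 * count N (2 + h) n + count E h (suc n)
count-E-suc h n = trans
  (length-++ (map rise⁺ ws ++ map fall⁺ ws))
  (cong₂ _+_
    (trans (length-++ (map rise⁺ ws))
      (cong₂ _+_ (length-map rise⁺ ws)
        (trans (length-map fall⁺ ws) (sym (ℕ.+-identityʳ _)))))
    (length-map east⁺ (markedWords E h (suc n))))
  where ws = markedWords N (2 + h) n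

-- Splitting at the first return to height h; schröder and count E 0 count the
-- excursion above h + 1 that precedes the return, after a north and an east step.
first-return : ∀ n h → count N (suc h) n ≡ (count E h ⋆ schröder) n
                     × count E (suc h) n ≡ (count E h ⋆ count E 0) n
first-return n = go n n ℕ.≤-refl
  where
  -- `k` bounds `n` and carries a strong induction: the claim is used at every `i ≤ n`, and at the
  -- heights `suc h`, `h` and 0.
  go : ∀ k n → n ≤ k → ∀ h → count N (suc h) n ≡ (count E h ⋆ schröder) n
                           × count E (suc h) n ≡ (count E h ⋆ count E 0) n
  go k zero n≤k h =
    trans (count-suc-zero N h) (sym (ℕ.*-identityʳ _)) ,
    trans (count-suc-zero E h) (sym (ℕ.*-identityʳ _))
  go (suc k) (suc n) (s≤s n≤k) h =
    (begin
      count N (suc h) (suc n)                                      ≡⟨ count-N-suc h n ⟩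
      count N (2 + h) n + count E h (suc n)                        ≡⟨ cong₂ _+_ two-up (sym (ℕ.*-identityʳ _)) ⟩
      (count E h ⋆ schröder ∘ suc) n + count E h (suc n) * 1       ≡⟨ ⋆-sucʳ (count E h) schröder n ⟨
      (count E h ⋆ schröder) (suc n)                               ∎) ,
    (begin
      count E (suc h) (suc n)                                      ≡⟨ count-E-suc h n ⟩
      2 * count N (2 + h) n + count E h (suc n)                    ≡⟨ cong₂ _+_ two-up′ (sym (ℕ.*-identityʳ _)) ⟩
      (count E h ⋆ count E 0 ∘ suc) n + count E h (suc n) * 1      ≡⟨ ⋆-sucʳ (count E h) (count E 0) n ⟨
      (count E h ⋆ count E 0) (suc n)                              ∎)
    where
    open ≡-Reasoning

    -- A path from height `h + 2` returns first to `h + 1` and then to `h`. After reassociation, the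
    -- claim at height 0 merges the two upper factors `count E 0` and `schröder` into
    -- `schröder ∘ suc`.
    two-up : count N (2 + h) n ≡ (count E h ⋆ schröder ∘ suc) n
    two-up = begin
      count N (2 + h) n                        ≡⟨ proj₁ (go k n n≤k (suc h)) ⟩
      (count E (suc h) ⋆ schröder) n           ≡⟨ ⋆-cong n (λ i i≤n → proj₂ (go k i (ℕ.≤-trans i≤n n≤k) h)) (λ _ _ → refl) ⟩
      (count E h ⋆ count E 0 ⋆ schröder) n     ≡⟨ ⋆-assoc (count E h) (count E 0) schröder n ⟩
      (count E h ⋆ (count E 0 ⋆ schröder)) n   ≡⟨ ⋆-cong n (λ _ _ → refl) (λ i i≤n → sym (trans (count-N-zero i) (proj₁ (go k i (ℕ.≤-trans i≤n n≤k) 0)))) ⟩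
      (count E h ⋆ schröder ∘ suc) n           ∎

    -- The factor 2, the choice of mark for the north step just taken, is absorbed by
    -- `count-E-zero`.
    two-up′ : 2 * count N (2 + h) n ≡ (count E h ⋆ count E 0 ∘ suc) n
    two-up′ = begin
      2 * count N (2 + h) n                              ≡⟨ cong (2 *_) two-up ⟩
      2 * (count E h ⋆ schröder ∘ suc) n                 ≡⟨ ⋆-*ʳ 2 (count E h) (schröder ∘ suc) n ⟨
      (count E h ⋆ (λ i → 2 * schröder (suc i))) n       ≡⟨ ⋆-cong n (λ _ _ → refl) (λ i _ → sym (count-E-zero i)) ⟩
      (count E h ⋆ count E 0 ∘ suc) n                    ∎

schröder-recurrence : ∀ n → schröder (suc n) ≡
                      schröder n + 2 * Σ₁ n (λ i → schröder i * schröder (n ∸ i))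
schröder-recurrence n = begin
  schröder (suc n)             ≡⟨ count-N-zero n ⟩
  count N 1 n                  ≡⟨ proj₁ (first-return n 0) ⟩
  (count E 0 ⋆ schröder) n     ≡⟨ unfold n ⟩
  schröder n + 2 * Σ₁ n (λ i → schröder i * schröder (n ∸ i)) ∎
  where
  open ≡-Reasoning

  unfold : ∀ n → (count E 0 ⋆ schröder) n ≡
           schröder n + 2 * Σ₁ n (λ i → schröder i * schröder (n ∸ i))
  unfold zero    = refl
  -- The term with index 0 has `count E 0 0 ≡ 1` and is the undoubled summand; all other terms are
  -- doubled by `count-E-zero`.
  unfold (suc n) = cong₂ _+_ (ℕ.*-identityˡ _) (begin
    (count E 0 ∘ suc ⋆ schröder) n
      ≡⟨ ⋆-cong n (λ i _ → count-E-zero i) (λ _ _ → refl) ⟩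
    ((λ i → 2 * schröder (suc i)) ⋆ schröder) n
      ≡⟨ ⋆-*ˡ 2 (schröder ∘ suc) schröder n ⟩
    2 * (schröder ∘ suc ⋆ schröder) n
      ≡⟨ cong (2 *_) (⋆-sum (schröder ∘ suc) schröder n) ⟩
    2 * sum (applyUpTo (λ i → schröder (suc i) * schröder (n ∸ i)) (suc n))
      ≡⟨ cong (λ xs → 2 * sum xs) (map-applyUpTo suc (λ i → schröder i * schröder (suc n ∸ i)) (suc n)) ⟨
    2 * Σ₁ (suc n) (λ i → schröder i * schröder (suc n ∸ i)) ∎)

-- Comparisons as Booleans

<⇒<ᵇ≡true : ∀ {m n} → m < n → (m <ᵇ n) ≡ true
<⇒<ᵇ≡true {m} {n} m<n with m <ᵇ n | ℕ.<ᵇ-reflects-< m n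
... | true  | _        = refl
... | false | ofⁿ m≮n = contradiction m<n m≮n

≥⇒<ᵇ≡false : ∀ {m n} → n ≤ m → (m <ᵇ n) ≡ false
≥⇒<ᵇ≡false {m} {n} n≤m with m <ᵇ n | ℕ.<ᵇ-reflects-< m n
... | true  | ofʸ m<n = contradiction m<n (ℕ.≤⇒≯ n≤m)
... | false | _        = refl

<ᵇ≡true⇒< : ∀ {m n} → (m <ᵇ n) ≡ true → m < n
<ᵇ≡true⇒< {m} {n} eq with m <ᵇ n | ℕ.<ᵇ-reflects-< m n
<ᵇ≡true⇒< refl | true | ofʸ m<n = m<n

<ᵇ≡false⇒≥ : ∀ {m n} → (m <ᵇ n) ≡ false → n ≤ m
<ᵇ≡false⇒≥ {m} {n} eq with m <ᵇ n | ℕ.<ᵇ-reflects-< m n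
<ᵇ≡false⇒≥ refl | false | ofⁿ m≮n = ℕ.≮⇒≥ m≮n

-- An inductive form, so that coherence can be carried along when a first entry is added or removed;
-- `allTriples⁺` and `allTriples⁻` translate to the positions that pattern occurrences speak of.
data AllTriples {A : Set} (R : A → A → A → Set) : List A → Set where
  []  : AllTriples R []
  _∷_ : ∀ {x xs} → AllPairs (R x) xs → AllTriples R xs → AllTriples R (x ∷ xs)

module _ {A : Set} {R : A → A → A → Set} where

  allTriples⁺ : ∀ xs → (∀ i j k → i Fin.< j → j Fin.< k →
                        R (lookup xs i) (lookup xs j) (lookup xs k)) → AllTriples R xs
  allTriples⁺ []       _ = []
  allTriples⁺ (x ∷ xs) r =
    allPairs⁺ xs (λ j k j<k → r zero (suc j) (suc k) z<s (s<s j<k))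
    ∷ allTriples⁺ xs λ i j k i<j j<k → r (suc i) (suc j) (suc k) (s<s i<j) (s<s j<k)

  allTriples⁻ : ∀ {xs} → AllTriples R xs → ∀ i j k → i Fin.< j → j Fin.< k →
                R (lookup xs i) (lookup xs j) (lookup xs k)
  allTriples⁻ (r ∷ _)  zero    (suc j) (suc k) _         (s<s j<k) = allPairs⁻ r j k j<k
  allTriples⁻ (_ ∷ rs) (suc i) (suc j) (suc k) (s<s i<j) (s<s j<k) = allTriples⁻ rs i j k i<j j<k

module _ {A B : Set} {f : A → B} {R : B → B → B → Set} where

  allTriples-map⁺ : ∀ {xs} → AllTriples (λ x y z → R (f x) (f y) (f z)) xs →
                    AllTriples R (map f xs)
  allTriples-map⁺ []       = []
  allTriples-map⁺ (r ∷ rs) = AllPairs.map⁺ r ∷ allTriples-map⁺ rs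

  allTriples-map⁻ : ∀ {xs} → AllTriples R (map f xs) →
                    AllTriples (λ x y z → R (f x) (f y) (f z)) xs
  allTriples-map⁻ {[]}     []       = []
  allTriples-map⁻ {_ ∷ _} (r ∷ rs) = AllPairs.map⁻ r ∷ allTriples-map⁻ rs

_≺_ : ∀ {n} → Fin n → Fin n → Bool
a ≺ b = toℕ a <ᵇ toℕ b

rises : ∀ {n} → Fin n → List (Fin n) → List Bool
rises a []      = []
rises a (b ∷ l) = (a ≺ b) ∷ rises b l

-- Order-isomorphic permutations are equal

-- Each entry is compared with all later ones as a row of Booleans. Equality of rows also makes the
-- lengths agree.
data OrderIso {m n} : List (Fin m) → List (Fin n) → Set where
  []  : OrderIso [] []
  _∷_ : ∀ {a b k l} → map (a ≺_) k ≡ map (b ≺_) l → OrderIso k l → OrderIso (a ∷ k) (b ∷ l)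

OrderIso-sym : ∀ {m n} {k : List (Fin m)} {l : List (Fin n)} → OrderIso k l → OrderIso l k
OrderIso-sym []       = []
OrderIso-sym (r ∷ rs) = sym r ∷ OrderIso-sym rs

module _ {A B : Set} where

  zip-swap : ∀ (xs : List A) (ys : List B) {x y} → (x , y) ∈ zip xs ys → (y , x) ∈ zip ys xs
  zip-swap (_ ∷ xs) (_ ∷ ys) (here refl) = here refl
  zip-swap (_ ∷ xs) (_ ∷ ys) (there p∈)  = there (zip-swap xs ys p∈)

  zip-∈ˡ : ∀ (xs : List A) (ys : List B) {x y} → (x , y) ∈ zip xs ys → x ∈ xs
  zip-∈ˡ (_ ∷ xs) (_ ∷ ys) (here refl) = here refl
  zip-∈ˡ (_ ∷ xs) (_ ∷ ys) (there p∈)  = there (zip-∈ˡ xs ys p∈)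

zip-map : ∀ {A B C : Set} {f : A → C} {g : B → C} xs ys → map f xs ≡ map g ys →
          ∀ {x y} → (x , y) ∈ zip xs ys → f x ≡ g y
zip-map (_ ∷ xs) (_ ∷ ys) eq (here refl) = proj₁ (∷-injective eq)
zip-map (_ ∷ xs) (_ ∷ ys) eq (there p∈)  = zip-map xs ys (proj₂ (∷-injective eq)) p∈

iso-total : ∀ {m n} {k : List (Fin m)} {l : List (Fin n)} → OrderIso k l →
            ∀ {x} → x ∈ k → ∃[ y ] (x , y) ∈ zip k l
iso-total (_ ∷ rs) (here refl) = _ , here refl
iso-total (_ ∷ rs) (there x∈)  = let y , p∈ = iso-total rs x∈ in y , there p∈

-- If the smaller entry `x` stands after `y`, the row of `y` yields only `x′ ≤ y′`; uniqueness of
-- `l` makes this strict.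
iso-mono : ∀ {m n} {k : List (Fin m)} {l : List (Fin n)} → OrderIso k l → Unique l →
           ∀ {x y x′ y′} → (x , x′) ∈ zip k l → (y , y′) ∈ zip k l → x Fin.< y → x′ Fin.< y′
iso-mono (_ ∷ _) _ (here refl) (here refl) x<x = ⊥-elim (ℕ.<-irrefl refl x<x)
iso-mono {k = _ ∷ k} {_ ∷ l} (r ∷ _) _ (here refl) (there q∈) x<y =
  <ᵇ≡true⇒< (trans (sym (zip-map k l r q∈)) (<⇒<ᵇ≡true x<y))
iso-mono {k = _ ∷ k} {_ ∷ l} (r ∷ _) (y′∉ ∷ _) (there p∈) (here refl) x<y =
  ℕ.≤∧≢⇒<
    (<ᵇ≡false⇒≥ (trans (sym (zip-map k l r p∈)) (≥⇒<ᵇ≡false (ℕ.<⇒≤ x<y))))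
    (λ eq → All.lookup y′∉ (zip-∈ˡ l k (zip-swap k l p∈)) (sym (Fin.toℕ-injective eq)))
iso-mono (_ ∷ rs) (_ ∷ l!) (there p∈) (there q∈) x<y = iso-mono rs l! p∈ q∈ x<y

-- Induction on `x`: the image of `x` exceeds that of its predecessor, which is at least the
-- predecessor itself.
monotone⇒inflationary : ∀ {n} (Z : Fin n → Fin n → Set) → (∀ x → ∃[ y ] Z x y) →
  (∀ {x y x′ y′} → Z x x′ → Z y y′ → x Fin.< y → x′ Fin.< y′) →
  ∀ x {y} → Z x y → x Fin.≤ y
monotone⇒inflationary {suc n} Z total mono =
  <-weakInduction (λ x → ∀ {y} → Z x y → x Fin.≤ y) (λ _ → z≤n) λ i below z →
    let w , z′ = total (inject₁ i) in
    ℕ.≤-<-trans (subst (_≤ toℕ w) (Fin.toℕ-inject₁ i) (below z′))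
                (mono z′ z (s≤s (ℕ.≤-reflexive (Fin.toℕ-inject₁ i))))

-- The correspondence of entries at equal positions is strictly monotone and total in both
-- directions, hence inflationary in both, hence the identity.
iso⇒≡ : ∀ {n} {k l : List (Fin n)} → Unique k → Unique l →
        (∀ x → x ∈ k) → (∀ x → x ∈ l) → OrderIso k l → k ≡ l
iso⇒≡ {k = k} {l} k! l! k∋ l∋ iso = zip-≡ iso λ {x} {y} p∈ → Fin.≤-antisym
  (monotone⇒inflationary (λ x y → (x , y) ∈ zip k l)
    (λ x → iso-total iso (k∋ x)) (iso-mono iso l!) x p∈)
  (monotone⇒inflationary (λ y x → (y , x) ∈ zip l k)
    (λ y → iso-total (OrderIso-sym iso) (l∋ y)) (iso-mono (OrderIso-sym iso) k!) y
    (zip-swap k l p∈))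
  where
  zip-≡ : ∀ {n} {k l : List (Fin n)} → OrderIso k l → (∀ {x y} → (x , y) ∈ zip k l → x ≡ y) → k ≡ l
  zip-≡ []       _  = refl
  zip-≡ (_ ∷ rs) eq = cong₂ _∷_ (eq (here refl)) (zip-≡ rs (eq ∘ there))

-- Inserting a new first entry

≺-punchIn : ∀ {n} (a : Fin (suc n)) x → (a ≺ punchIn a x) ≡ not (toℕ x <ᵇ toℕ a)
≺-punchIn zero    x       = refl
≺-punchIn (suc a) zero    = refl
≺-punchIn (suc a) (suc x) = ≺-punchIn a x

punchIn-≺ : ∀ {n} (a : Fin (suc n)) x y → (punchIn a x ≺ punchIn a y) ≡ (x ≺ y)
punchIn-≺ zero    x       y       = refl
punchIn-≺ (suc a) zero    zero    = refl
punchIn-≺ (suc a) zero    (suc y) = refl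
punchIn-≺ (suc a) (suc x) zero    = refl
punchIn-≺ (suc a) (suc x) (suc y) = punchIn-≺ a x y

≺-flip : ∀ {n} (x y : Fin n) → x ≢ y → (x ≺ y) ≡ not (y ≺ x)
≺-flip x y x≢y with Fin.<-cmp x y
... | tri< x<y _ _ rewrite <⇒<ᵇ≡true x<y | ≥⇒<ᵇ≡false (ℕ.<⇒≤ x<y) = refl
... | tri≈ _ x≡y _ = contradiction x≡y x≢y
... | tri> _ _ y<x rewrite <⇒<ᵇ≡true y<x | ≥⇒<ᵇ≡false (ℕ.<⇒≤ y<x) = refl

-- The new entry compares to the old first entry b as prescribed by m, and to the
-- entries x with (b ≺ x) ≡ not m as prescribed by c.
first : ∀ {n} → Bool → Bool → Fin (suc n) → Fin (suc (suc n))
first true  true  b = zero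
first true  false b = inject₁ b
first false true  b = suc b
first false false b = fromℕ _

first-head : ∀ {n} m c (b : Fin (suc n)) → let a = first m c b in (a ≺ punchIn a b) ≡ m
first-head true  true  b = refl
first-head true  false b = trans (≺-punchIn (inject₁ b) b)
  (cong not (≥⇒<ᵇ≡false (ℕ.≤-reflexive (Fin.toℕ-inject₁ b))))
first-head false true  b = trans (≺-punchIn (suc b) b) (cong not (<⇒<ᵇ≡true (ℕ.n<1+n (toℕ b))))
first-head false false b = trans (≺-punchIn (fromℕ _) b)
  (cong not (<⇒<ᵇ≡true (subst (toℕ b <_) (sym (Fin.toℕ-fromℕ _)) (Fin.toℕ<n b))))

suc-<ᵇ : ∀ {m n} → m ≢ n → (m <ᵇ suc n) ≡ (m <ᵇ n)
suc-<ᵇ {m} {n} m≢n with ℕ.<-cmp m n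
... | tri< m<n _ _ = trans (<⇒<ᵇ≡true (ℕ.m<n⇒m<1+n m<n)) (sym (<⇒<ᵇ≡true m<n))
... | tri≈ _ m≡n _ = contradiction m≡n m≢n
... | tri> _ _ n<m = trans (≥⇒<ᵇ≡false n<m) (sym (≥⇒<ᵇ≡false (ℕ.<⇒≤ n<m)))

-- The new entry lies below `b`, so whatever is above `b` is above it too. The entries below `b` all
-- end up above `zero`, or all below `inject₁ b`, which sits directly under the shifted `b`.
-- `first-false` is the mirror image.
first-true : ∀ {n} c (b : Fin (suc n)) x → b ≢ x →
             let a = first true c b in (a ≺ punchIn a x) ≡ (b ≺ x) ∨ c
first-true true  b x b≢x = sym (∨-zeroʳ (b ≺ x))
first-true false b x b≢x = begin
  (inject₁ b ≺ punchIn (inject₁ b) x)   ≡⟨ ≺-punchIn (inject₁ b) x ⟩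
  not (toℕ x <ᵇ toℕ (inject₁ b))        ≡⟨ cong (λ k → not (toℕ x <ᵇ k)) (Fin.toℕ-inject₁ b) ⟩
  not (x ≺ b)                           ≡⟨ ≺-flip b x b≢x ⟨
  (b ≺ x)                               ≡⟨ ∨-identityʳ (b ≺ x) ⟨
  (b ≺ x) ∨ false                       ∎
  where open ≡-Reasoning

first-false : ∀ {n} c (b : Fin (suc n)) x → b ≢ x →
              let a = first false c b in (a ≺ punchIn a x) ≡ (b ≺ x) ∧ c
first-false true b x b≢x = begin
  (suc b ≺ punchIn (suc b) x)           ≡⟨ ≺-punchIn (suc b) x ⟩
  not (toℕ x <ᵇ suc (toℕ b))            ≡⟨ cong not (suc-<ᵇ (b≢x ∘ sym ∘ Fin.toℕ-injective)) ⟩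
  not (x ≺ b)                           ≡⟨ ≺-flip b x b≢x ⟨
  (b ≺ x)                               ≡⟨ ∧-identityʳ (b ≺ x) ⟨
  (b ≺ x) ∧ true                        ∎
  where open ≡-Reasoning
first-false {n} false b x b≢x = begin
  (fromℕ (suc n) ≺ punchIn (fromℕ (suc n)) x) ≡⟨ ≺-punchIn (fromℕ (suc n)) x ⟩
  not (toℕ x <ᵇ toℕ (fromℕ (suc n)))          ≡⟨ cong not (<⇒<ᵇ≡true (subst (toℕ x <_) (sym (Fin.toℕ-fromℕ _)) (Fin.toℕ<n x))) ⟩
  false                                 ≡⟨ ∧-zeroʳ (b ≺ x) ⟨
  (b ≺ x) ∧ false                       ∎
  where open ≡-Reasoning

-- Permutations coherent with a band operation: uniqueness and existence for each ascent pattern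

module Band (_∙_ : Op₂ Bool) (isBand : IsBand _≡_ _∙_) where

  open IsBand isBand using (assoc; idem)

  Coherent : ∀ {n} → List (Fin n) → Set
  Coherent = AllTriples λ x y z → (x ≺ z) ≡ (x ≺ y) ∙ (y ≺ z)

  -- The comparisons of a first entry with all later ones, rebuilt from the consecutive comparisons:
  -- the products `m₁`, `m₁ ∙ m₂`, `m₁ ∙ (m₂ ∙ m₃)` and so on.
  comparisons : List Bool → List Bool
  comparisons []       = []
  comparisons (m ∷ ms) = m ∷ map (m ∙_) (comparisons ms)

  comparisons-rises : ∀ {n} {a : Fin n} {l} → Coherent (a ∷ l) →
                      map (a ≺_) l ≡ comparisons (rises a l)
  comparisons-rises {l = []}    _ = refl
  comparisons-rises {a = a} {b ∷ l} ((r ∷ _) ∷ coh) = cong ((a ≺ b) ∷_) (begin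
    map (a ≺_) l                              ≡⟨ map-cong-local r ⟩
    map (λ x → (a ≺ b) ∙ (b ≺ x)) l           ≡⟨ map-∘ l ⟩
    map ((a ≺ b) ∙_) (map (b ≺_) l)           ≡⟨ cong (map _) (comparisons-rises coh) ⟩
    map ((a ≺ b) ∙_) (comparisons (rises b l)) ∎)
    where open ≡-Reasoning

  -- The uniqueness half: by `comparisons-rises` every row of comparisons is a function of the
  -- ascent pattern.
  rises⇒iso : ∀ {m n} {a : Fin m} {b : Fin n} {k l} → Coherent (a ∷ k) → Coherent (b ∷ l) →
              rises a k ≡ rises b l → OrderIso (a ∷ k) (b ∷ l)
  rises⇒iso {k = []}    {[]}    _ _ _ = refl ∷ []
  rises⇒iso {k = _ ∷ _} {_ ∷ _} coh@(_ ∷ coh₁) coh′@(_ ∷ coh₁′) eq =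
    trans (comparisons-rises coh) (trans (cong comparisons eq) (sym (comparisons-rises coh′)))
    ∷ rises⇒iso coh₁ coh₁′ (proj₂ (∷-injective eq))

  -- This explains the argument `m ∙ not m` of `first`: entries with `(b ≺ x) ≡ not m` must receive
  -- that value, and those with `(b ≺ x) ≡ m` receive `m ∙ m`, which is `m` by idempotence.
  first-tail : ∀ {n} m (b : Fin (suc n)) x → b ≢ x →
               let a = first m (m ∙ not m) b in (a ≺ punchIn a x) ≡ m ∙ (b ≺ x)
  first-tail true b x b≢x = trans (first-true (true ∙ false) b x b≢x) (join (b ≺ x))
    where
    join : ∀ q → q ∨ (true ∙ false) ≡ true ∙ q
    join true  = sym (idem true)
    join false = refl
  first-tail false b x b≢x = trans (first-false (false ∙ true) b x b≢x) (meet (b ≺ x))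
    where
    meet : ∀ q → q ∧ (false ∙ true) ≡ false ∙ q
    meet true  = refl
    meet false = sym (idem false)

  -- The existence half, built from the last entry backwards. The first entry is kept apart because
  -- the next insertion is placed relative to it.
  perm : (ms : List Bool) → Fin (suc (length ms)) × List (Fin (suc (length ms)))
  perm []       = zero , []
  perm (m ∷ ms) = let b , l = perm ms ; a = first m (m ∙ not m) b in
    a , map (punchIn a) (b ∷ l)

  permutation : (ms : List Bool) → List (Fin (suc (length ms)))
  permutation ms = proj₁ (perm ms) ∷ proj₂ (perm ms)

  length-permutation : ∀ ms → length (permutation ms) ≡ suc (length ms)
  length-permutation []       = refl
  length-permutation (m ∷ ms) =
    cong suc (trans (length-map (punchIn _) (permutation ms)) (length-permutation ms))

  permutation-unique : ∀ ms → Unique (permutation ms)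
  permutation-unique []       = [] ∷ []
  permutation-unique (m ∷ ms) =
    All.map⁺ (All.tabulate λ _ eq → Fin.punchInᵢ≢i a _ (sym eq))
    ∷ Unique.map⁺ (Fin.punchIn-injective a _ _) (permutation-unique ms)
    where a = proj₁ (perm (m ∷ ms))

  permutation-complete : ∀ ms x → x ∈ permutation ms
  permutation-complete []       zero = here refl
  permutation-complete (m ∷ ms) x with proj₁ (perm (m ∷ ms)) Fin.≟ x
  ... | yes a≡x = here (sym a≡x)
  ... | no  a≢x = there (subst (_∈ _) (Fin.punchIn-punchOut a≢x)
                    (∈-map⁺ (punchIn _) (permutation-complete ms (punchOut a≢x))))

  rises-map : ∀ {n} (a : Fin (suc n)) b l →
              rises (punchIn a b) (map (punchIn a) l) ≡ rises b l
  rises-map a b []      = refl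
  rises-map a b (c ∷ l) = cong₂ _∷_ (punchIn-≺ a b c) (rises-map a c l)

  rises-permutation : ∀ ms → rises (proj₁ (perm ms)) (proj₂ (perm ms)) ≡ ms
  rises-permutation []       = refl
  rises-permutation (m ∷ ms) = let b , l = perm ms ; a = first m (m ∙ not m) b in
    cong₂ _∷_ (first-head m (m ∙ not m) b) (trans (rises-map a b l) (rises-permutation ms))

  coherent-punchIn : ∀ {n} (a : Fin (suc n)) {l} → Coherent l → Coherent (map (punchIn a) l)
  coherent-punchIn a coh = allTriples-map⁺ (mapTriples coh)
    where
    mapTriples : ∀ {l} → Coherent l → AllTriples (λ x y z → (punchIn a x ≺ punchIn a z) ≡
                   (punchIn a x ≺ punchIn a y) ∙ (punchIn a y ≺ punchIn a z)) l
    mapTriples []       = []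
    mapTriples (r ∷ rs) = AllPairs.map (λ {y} {z} eq → trans (punchIn-≺ a _ z)
      (trans eq (sym (cong₂ _∙_ (punchIn-≺ a _ y) (punchIn-≺ a y z))))) r ∷ mapTriples rs

  -- Only triples starting with the new entry `a` are new. If the middle entry is the old first
  -- entry `b`, `first-tail` is the claim; if it stands after `b`, the coherent triple at `b` is
  -- multiplied by `m` on the left and reassociated.
  coherent-permutation : ∀ ms → Coherent (permutation ms)
  coherent-permutation []       = [] ∷ []
  coherent-permutation (m ∷ ms) with perm ms | coherent-permutation ms | permutation-unique ms
  ... | b , l | coh@(r ∷ _) | b∉l ∷ _ =
    AllPairs.map⁺ (All.tabulate (λ {y} y∈ → begin
        (a ≺ punchIn a y)                                  ≡⟨ first-tail m b y (All.lookup b∉l y∈) ⟩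
        m ∙ (b ≺ y)                                        ≡⟨ cong₂ _∙_ (first-head m (m ∙ not m) b) (punchIn-≺ a b y) ⟨
        (a ≺ punchIn a b) ∙ (punchIn a b ≺ punchIn a y)    ∎)
      ∷ allPairs-∈ r (λ {x} {y} x∈ y∈ eq → begin
        (a ≺ punchIn a y)                                  ≡⟨ first-tail m b y (All.lookup b∉l y∈) ⟩
        m ∙ (b ≺ y)                                        ≡⟨ cong (m ∙_) eq ⟩
        m ∙ ((b ≺ x) ∙ (x ≺ y))                            ≡⟨ assoc m _ _ ⟨
        (m ∙ (b ≺ x)) ∙ (x ≺ y)                            ≡⟨ cong₂ _∙_ (first-tail m b x (All.lookup b∉l x∈)) (punchIn-≺ a x y) ⟨
        (a ≺ punchIn a x) ∙ (punchIn a x ≺ punchIn a y)    ∎))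
    ∷ coherent-punchIn a coh
    where
    open ≡-Reasoning
    a = first m (m ∙ not m) b
    allPairs-∈ : ∀ {A : Set} {P Q : A → A → Set} {xs} → AllPairs P xs →
                 (∀ {x y} → x ∈ xs → y ∈ xs → P x y → Q x y) → AllPairs Q xs
    allPairs-∈ []       _ = []
    allPairs-∈ (p ∷ ps) f = All.tabulate (λ y∈ → f (here refl) (there y∈) (All.lookup p y∈))
      ∷ allPairs-∈ ps λ x∈ y∈ → f (there x∈) (there y∈)

-- Avoidance

-- For distinct numbers these Booleans determine the order type, and the third is open only if the
-- first two differ.
shape : ℕ → ℕ → ℕ → Bool × Bool × Bool
shape x y z = (x <ᵇ y) , (y <ᵇ z) , (x <ᵇ z)

<ᵇ-cong : ∀ {x y x′ y′} → y ≤ x ⇔ y′ ≤ x′ → (x <ᵇ y) ≡ (x′ <ᵇ y′)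
<ᵇ-cong {x} {y} {x′} {y′} e with x <ᵇ y in eq | x′ <ᵇ y′ in eq′
... | true  | true  = refl
... | false | false = refl
... | true  | false =
  contradiction (<ᵇ≡true⇒< eq) (ℕ.≤⇒≯ (Equivalence.from e (<ᵇ≡false⇒≥ {x′} eq′)))
... | false | true  =
  contradiction (<ᵇ≡true⇒< eq′) (ℕ.≤⇒≯ (Equivalence.to e (<ᵇ≡false⇒≥ {x} eq)))

≤-cong : ∀ {x y x′ y′} → x ≢ y → x′ ≢ y′ → (x <ᵇ y) ≡ (x′ <ᵇ y′) →
         (x ≤ y ⇔ x′ ≤ y′) × (y ≤ x ⇔ y′ ≤ x′)
≤-cong {x} {y} {x′} {y′} x≢y x′≢y′ eq =
  mk⇔ (forth x≢y eq) (forth x′≢y′ (sym eq)) , mk⇔ (back eq) (back (sym eq))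
  where
  forth : ∀ {x y x′ y′} → x ≢ y → (x <ᵇ y) ≡ (x′ <ᵇ y′) → x ≤ y → x′ ≤ y′
  forth x≢y eq x≤y = ℕ.<⇒≤ (<ᵇ≡true⇒< (trans (sym eq) (<⇒<ᵇ≡true (ℕ.≤∧≢⇒< x≤y x≢y))))

  back : ∀ {x y x′ y′} → (x <ᵇ y) ≡ (x′ <ᵇ y′) → y ≤ x → y′ ≤ x′
  back {x′ = x′} eq y≤x = <ᵇ≡false⇒≥ {x′} (trans (sym eq) (≥⇒<ᵇ≡false y≤x))

module _ {π : List ℕ} {r s t : ℕ} where

  contains⇒shape : π Contains (r ∷ s ∷ t ∷ []) → ∃[ i ] ∃[ j ] ∃[ k ] (i Fin.< j × j Fin.< k ×
                   shape (lookup π i) (lookup π j) (lookup π k) ≡ shape r s t)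
  contains⇒shape (i ∷ j ∷ k ∷ [] , occ) =
    i , j , k , increasing zero (suc zero) z<s , increasing (suc zero) (suc (suc zero)) (s<s z<s) ,
    cong₂ _,_ (<ᵇ-cong (sameOrder (suc zero) zero))
      (cong₂ _,_ (<ᵇ-cong (sameOrder (suc (suc zero)) (suc zero)))
        (<ᵇ-cong (sameOrder (suc (suc zero)) zero)))
    where open IsOccurrence occ

  -- Distinctness on both sides turns each equality of strict comparisons into the two equivalences
  -- of weak ones that `sameOrder` demands.
  shape⇒contains : Unique π → Unique (r ∷ s ∷ t ∷ []) → ∀ i j k → i Fin.< j → j Fin.< k →
                   shape (lookup π i) (lookup π j) (lookup π k) ≡ shape r s t →
                   π Contains (r ∷ s ∷ t ∷ [])
  shape⇒contains π! ((r≢s ∷ r≢t ∷ []) ∷ (s≢t ∷ []) ∷ [] ∷ []) i j k i<j j<k eq =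
    i ∷ j ∷ k ∷ [] , record { increasing = incr ; sameOrder = same }
    where
    ρ = r ∷ s ∷ t ∷ []
    ι = i ∷ j ∷ k ∷ []

    incr : ∀ a b → a Fin.< b → Vec.lookup ι a Fin.< Vec.lookup ι b
    incr zero          (suc zero)       _ = i<j
    incr zero          (suc (suc zero)) _ = ℕ.<-trans i<j j<k
    incr (suc zero)    (suc (suc zero)) _ = j<k
    incr (suc zero)       (suc zero) (s<s ())
    incr (suc (suc zero)) (suc zero) (s<s ())
    incr (suc (suc zero)) (suc (suc zero)) (s<s (s<s ()))

    ij = ≤-cong (allPairs⁻ π! i j i<j) r≢s (cong proj₁ eq)
    jk = ≤-cong (allPairs⁻ π! j k j<k) s≢t (cong (proj₁ ∘ proj₂) eq)
    ik = ≤-cong (allPairs⁻ π! i k (ℕ.<-trans i<j j<k)) r≢t (cong (proj₂ ∘ proj₂) eq)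

    refl⇔ : ∀ {x y : ℕ} → x ≤ x ⇔ y ≤ y
    refl⇔ = mk⇔ (λ _ → ℕ.≤-refl) (λ _ → ℕ.≤-refl)

    same : ∀ a b → lookup π (Vec.lookup ι a) ≤ lookup π (Vec.lookup ι b) ⇔
                   lookup ρ a ≤ lookup ρ b
    same zero             zero             = refl⇔
    same zero             (suc zero)       = proj₁ ij
    same zero             (suc (suc zero)) = proj₁ ik
    same (suc zero)       zero             = proj₂ ij
    same (suc zero)       (suc zero)       = refl⇔
    same (suc zero)       (suc (suc zero)) = proj₁ jk
    same (suc (suc zero)) zero             = proj₂ ik
    same (suc (suc zero)) (suc zero)       = proj₂ jk
    same (suc (suc zero)) (suc (suc zero)) = refl⇔

-- Parking functions as marked Dyck paths

-- The Dyck condition for a path that starts `h` above the diagonal; `Above 0` unfolds to the type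
-- of `neverBelow`.
Above : ℕ → List Step → Set
Above h w = All (λ v → (# E) v ≤ h + (# N) v) (inits w)

above-N⁻ : ∀ {h w} → Above h (N ∷ w) → Above (suc h) w
above-N⁻ {h} (_ ∷ as) = All.map (λ {v} → subst ((# E) v ≤_) (ℕ.+-suc h _)) (All.map⁻ as)

above-N⁺ : ∀ {h w} → Above (suc h) w → Above h (N ∷ w)
above-N⁺ {h} as = z≤n ∷ All.map⁺ (All.map (λ {v} → subst ((# E) v ≤_) (sym (ℕ.+-suc h _))) as)

above-E⁻ : ∀ {h w} → Above (suc h) (E ∷ w) → Above h w
above-E⁻ (_ ∷ as) = All.map s≤s⁻¹ (All.map⁻ as)

above-E⁺ : ∀ {h w} → Above h w → Above (suc h) (E ∷ w)
above-E⁺ as = z≤n ∷ All.map⁺ (All.map s≤s as)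

marked-norths : ∀ {s h n w b} → Marked s h n w b → (# N) w ≡ n
marked-norths end      = refl
marked-norths (east m) = marked-norths m
marked-norths (rise m) = cong suc (marked-norths m)
marked-norths (fall m) = cong suc (marked-norths m)

marked-easts : ∀ {s h n w b} → Marked s h n w b → (# E) w ≡ h + n
marked-easts end      = refl
marked-easts (east m) = cong suc (marked-easts m)
marked-easts (rise m) = trans (marked-easts m) (sym (ℕ.+-suc _ _))
marked-easts (fall m) = trans (marked-easts m) (sym (ℕ.+-suc _ _))

marked-above : ∀ {s h n w b} → Marked s h n w b → Above h w
marked-above end      = z≤n ∷ []
marked-above (east m) = above-E⁺ (marked-above m)
marked-above (rise m) = above-N⁺ (marked-above m)
marked-above (fall m) = above-N⁺ (marked-above m)

marked-length : ∀ {s h n w b} → Marked s h n w b → length b ≡ n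
marked-length end      = refl
marked-length (east m) = marked-length m
marked-length (rise m) = cong suc (marked-length m)
marked-length (fall m) = cong suc (marked-length m)

-- Restores the step read just before a suffix. `Linked` then constrains the next label exactly when
-- that step was north, while the last label `a` stays available for computing the mark even after
-- east steps.
withLabel : ∀ {n} → Fin n → Step → LStep n
withLabel a N = N a
withLabel a E = E

-- After a north step `Linked` forces the mark to be an ascent; after an east step the comparison of
-- labels chooses between `rise` and `fall`.
marked⁺ : ∀ {n} s h k (a : Fin n) p → (# N) (map step p) ≡ k → (# E) (map step p) ≡ h + k →
          Above h (map step p) → Linked Ascending (withLabel a s ∷ p) →
          Marked s h k (map step p) (rises a (labels p))
marked⁺ s zero    zero a []      _  _  _ _ = end
marked⁺ s zero    k    a (E ∷ p) _  _  (_ ∷ () ∷ _) _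
marked⁺ s (suc h) k    a (E ∷ p) #N #E as (_ ∷ link) =
  east (marked⁺ E h k a p #N (ℕ.suc-injective #E) (above-E⁻ as) link)
marked⁺ N h (suc k) a (N b ∷ p) #N #E as (a<b ∷ link) rewrite <⇒<ᵇ≡true a<b =
  rise (marked⁺ N (suc h) k b p (ℕ.suc-injective #N) (trans #E (ℕ.+-suc h k)) (above-N⁻ as) link)
marked⁺ E h (suc k) a (N b ∷ p) #N #E as (_ ∷ link)
  with m ← marked⁺ N (suc h) k b p (ℕ.suc-injective #N) (trans #E (ℕ.+-suc h k)) (above-N⁻ as) link
  with a ≺ b
... | true  = rise m
... | false = fall m

-- The label condition has content only for two adjacent north steps. There the mark must come from
-- `rise`, and its value `true` is the required inequality.
marked-ascending : ∀ {n s h k w b} → Marked s h k w b → ∀ (a : Fin n) p →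
                   map step p ≡ w → rises a (labels p) ≡ b → Linked Ascending (withLabel a s ∷ p)
marked-ascending end a [] _ _ = [-]
marked-ascending {s = N} (east m) a (E ∷ p) eq eq′ =
  _ ∷ marked-ascending m a p (proj₂ (∷-injective eq)) eq′
marked-ascending {s = E} (east m) a (E ∷ p) eq eq′ =
  _ ∷ marked-ascending m a p (proj₂ (∷-injective eq)) eq′
marked-ascending {s = N} (rise m) a (N b ∷ p) eq eq′ =
  <ᵇ≡true⇒< (proj₁ (∷-injective eq′))
  ∷ marked-ascending m b p (proj₂ (∷-injective eq)) (proj₂ (∷-injective eq′))
marked-ascending {s = E} (rise m) a (N b ∷ p) eq eq′ =
  _ ∷ marked-ascending m b p (proj₂ (∷-injective eq)) (proj₂ (∷-injective eq′))
marked-ascending (fall m) a (N b ∷ p) eq eq′ =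
  _ ∷ marked-ascending m b p (proj₂ (∷-injective eq)) (proj₂ (∷-injective eq′))

steps-labels-injective : ∀ {n} (p q : List (LStep n)) →
                         map step p ≡ map step q → labels p ≡ labels q → p ≡ q
steps-labels-injective []        []        _  _   = refl
steps-labels-injective (E ∷ p)   (E ∷ q)   eq eq′ =
  cong (E ∷_) (steps-labels-injective p q (proj₂ (∷-injective eq)) eq′)
steps-labels-injective (N a ∷ p) (N b ∷ q) eq eq′ =
  cong₂ (λ c → N c ∷_) (proj₁ (∷-injective eq′))
    (steps-labels-injective p q (proj₂ (∷-injective eq)) (proj₂ (∷-injective eq′)))

fill : ∀ {n} w (l : List (Fin n)) → (# N) w ≡ length l → ∃[ p ] (map step p ≡ w × labels p ≡ l)
fill []      []      _  = [] , refl , refl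
fill (E ∷ w) l       eq = let p , eq₁ , eq₂ = fill w l eq in E ∷ p , cong (E ∷_) eq₁ , eq₂
fill (N ∷ w) (a ∷ l) eq =
  let p , eq₁ , eq₂ = fill w l (ℕ.suc-injective eq) in N a ∷ p , cong (N ∷_) eq₁ , cong (a ∷_) eq₂

-- The first entry is marked as an ascent.
marks : ∀ {n} → List (Fin n) → List Bool
marks []      = []
marks (a ∷ l) = true ∷ rises a l

encode : ∀ {n} → List (LStep n) → MarkedWord
encode p = map step p , marks (labels p)

encode-marked : ∀ {k} p → IsParkingFunction (suc k) p →
                Marked N 0 (suc k) (map step p) (marks (labels p))
encode-marked p pfp with IsParkingFunction.dyck pfp | IsParkingFunction.ascending pfp
encode-marked []        _ | record { norths = () } | _
encode-marked (E ∷ p)   _ | record { neverBelow = _ ∷ () ∷ _ } | _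
encode-marked (N a ∷ p) _ | record { norths = #N ; easts = #E ; neverBelow = as } | link =
  rise (marked⁺ N 1 _ a p (ℕ.suc-injective #N) #E (above-N⁻ as) link)

bijective⇒unique : ∀ {n} (l : List (Fin n)) → Bijective _≡_ _≡_ (lookup l) → Unique l
bijective⇒unique l (inj , _) = injective⇒unique l inj

bijective⇒complete : ∀ {n} (l : List (Fin n)) → Bijective _≡_ _≡_ (lookup l) → ∀ x → x ∈ l
bijective⇒complete l (_ , surj) x = let i , eq = surj x in subst (_∈ l) (eq refl) (∈-lookup i)

unique∧complete⇒bijective : ∀ {n} {l : List (Fin n)} → Unique l → (∀ x → x ∈ l) →
                            Bijective _≡_ _≡_ (lookup l)
unique∧complete⇒bijective l! l∋ =
  lookup-injective l! , λ x → Any.index (l∋ x) , λ { refl → sym (lookup-index (l∋ x)) }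

φ-unique : ∀ {n} {p : List (LStep n)} → IsParkingFunction n p → Unique (φ p)
φ-unique pfp = Unique.map⁺ (Fin.toℕ-injective ∘ ℕ.suc-injective)
  (bijective⇒unique _ (IsParkingFunction.bijective pfp))

-- For x, y, z in order of position, (x < z) is undetermined only if exactly one of x < y
-- and y < z holds; avoiding one pattern of each of the two shapes determines it.
module Count
  (_∙_ : Op₂ Bool) (isBand : IsBand _≡_ _∙_) (ρs : List (List ℕ))
  (r s t r′ s′ t′ : ℕ)
  (split : ∀ π → AvoidsAll ρs π ⇔ (π Avoids (r ∷ s ∷ t ∷ []) × π Avoids (r′ ∷ s′ ∷ t′ ∷ [])))
  (ρ! : Unique (r ∷ s ∷ t ∷ [])) (ρ′! : Unique (r′ ∷ s′ ∷ t′ ∷ []))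
  (rst : shape r s t ≡ (true , false , not (true ∙ false)))
  (rst′ : shape r′ s′ t′ ≡ (false , true , not (false ∙ true)))
  where

  open IsBand isBand using (idem)
  open Band _∙_ isBand

  avoids⇒coherent : ∀ {π} → Unique π → AvoidsAll ρs π →
                    AllTriples (λ x y z → (x <ᵇ z) ≡ (x <ᵇ y) ∙ (y <ᵇ z)) π
  avoids⇒coherent {π} π! av = allTriples⁺ π λ i j k i<j j<k →
    let x = lookup π i ; y = lookup π j ; z = lookup π k in
    triple x y z
      (avoids ∘ shape⇒contains π! ρ! i j k i<j j<k)
      (avoids′ ∘ shape⇒contains π! ρ′! i j k i<j j<k)
    where
    avoids  = proj₁ (Equivalence.to (split π) av)
    avoids′ = proj₂ (Equivalence.to (split π) av)

    triple : ∀ x y z → shape x y z ≢ shape r s t → shape x y z ≢ shape r′ s′ t′ →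
             (x <ᵇ z) ≡ (x <ᵇ y) ∙ (y <ᵇ z)
    triple x y z ≢ρ ≢ρ′ rewrite rst | rst′ with x <ᵇ y in xy | y <ᵇ z in yz
    -- When the two comparisons agree, transitivity decides the third and idempotence gives the
    -- product the same value. When they differ, a wrong third comparison would be the negated
    -- product, that is, a forbidden pattern.
    ... | true  | true  = trans (<⇒<ᵇ≡true (ℕ.<-trans (<ᵇ≡true⇒< {x} xy) (<ᵇ≡true⇒< {y} {z} yz))) (sym (idem true))
    ... | false | false = trans
      (≥⇒<ᵇ≡false (ℕ.≤-trans (<ᵇ≡false⇒≥ {y} {z} yz) (<ᵇ≡false⇒≥ {x} xy))) (sym (idem false))
    ... | true  | false with (x <ᵇ z) Bool.≟ (true ∙ false)
    ...   | yes eq = eq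
    ...   | no ≢   = contradiction (cong (λ q → true , false , q) (¬-not ≢)) ≢ρ
    triple x y z ≢ρ ≢ρ′ | false | true with (x <ᵇ z) Bool.≟ (false ∙ true)
    ...   | yes eq = eq
    ...   | no ≢   = contradiction (cong (λ q → false , true , q) (¬-not ≢)) ≢ρ′

  -- In an occurrence of either pattern the third comparison would be both the product of the other
  -- two and its negation.
  coherent⇒avoids : ∀ {π} → AllTriples (λ x y z → (x <ᵇ z) ≡ (x <ᵇ y) ∙ (y <ᵇ z)) π → AvoidsAll ρs π
  coherent⇒avoids {π} coh = Equivalence.from (split π)
    (avoids true false rst , avoids false true rst′)
    where
    avoids : ∀ {r s t} p q → shape r s t ≡ (p , q , not (p ∙ q)) → π Avoids (r ∷ s ∷ t ∷ [])
    avoids p q sh π∋ with contains⇒shape π∋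
    ... | i , j , k , i<j , j<k , eq with trans eq sh | allTriples⁻ coh i j k i<j j<k
    ...   | eq′ | c = not-¬ (trans (sym (cong (proj₂ ∘ proj₂) eq′)) (trans c
      (cong₂ _∙_ (cong proj₁ eq′) (cong (proj₁ ∘ proj₂) eq′)))) refl

  marks⇒iso : ∀ {m n} {k : List (Fin m)} {l : List (Fin n)} → Coherent k → Coherent l →
              marks k ≡ marks l → OrderIso k l
  marks⇒iso {k = []}    {[]}    _   _    _  = []
  marks⇒iso {k = _ ∷ _} {_ ∷ _} coh coh′ eq = rises⇒iso coh coh′ (proj₂ (∷-injective eq))

  -- The marks fix the labels up to order isomorphism, and both label lists are permutations of the
  -- same `Fin n`.
  encode-injective : ∀ {n p q} → IsParkingFunction n p → IsParkingFunction n q →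
                     AvoidsAll ρs (φ p) → AvoidsAll ρs (φ q) → encode p ≡ encode q → p ≡ q
  encode-injective {p = p} {q} pfp pfq avp avq eq =
    steps-labels-injective p q (cong proj₁ eq)
      (iso⇒≡ (bijective⇒unique _ (IsParkingFunction.bijective pfp))
             (bijective⇒unique _ (IsParkingFunction.bijective pfq))
             (bijective⇒complete _ (IsParkingFunction.bijective pfp))
             (bijective⇒complete _ (IsParkingFunction.bijective pfq))
             (marks⇒iso (allTriples-map⁻ (avoids⇒coherent (φ-unique pfp) avp))
                        (allTriples-map⁻ (avoids⇒coherent (φ-unique pfq) avq))
                        (cong proj₂ eq)))

  decode : ∀ {k w b} → Marked N 0 (suc k) w b →
           ∃[ p ] ((IsParkingFunction (suc k) p × AvoidsAll ρs (φ p)) × encode p ≡ (w , b))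
  -- Matching on the length identifies `k` with `length b`, so that `permutation b` has its labels
  -- in `Fin (suc k)`.
  decode (rise {w = w} {b} m) with refl ← marked-length m
    with fill (N ∷ w) (permutation b)
              (trans (cong suc (marked-norths m)) (sym (length-permutation b)))
  ... | N a ∷ p , steps≡ , labels≡ =
    N a ∷ p ,
    ( record
        { dyck = record
            { norths     = subst (λ v → (# N) v ≡ suc (length b)) (sym steps≡) (marked-norths (rise {s = N} m))
            ; easts      = subst (λ v → (# E) v ≡ suc (length b)) (sym steps≡) (marked-easts (rise {s = N} m))
            ; neverBelow = subst (Above 0) (sym steps≡) (marked-above (rise {s = N} m))
            }
        ; bijective = subst (λ l → Bijective _≡_ _≡_ (lookup l)) (sym labels≡)
            (unique∧complete⇒bijective (permutation-unique b) (permutation-complete b))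
        ; ascending = marked-ascending m a p (proj₂ (∷-injective steps≡)) rises≡
        }
    , coherent⇒avoids (allTriples-map⁺ (subst Coherent (sym labels≡) (coherent-permutation b)))) ,
    cong₂ _,_ steps≡ (cong (true ∷_) rises≡)
    where
    rises≡ : rises a (labels p) ≡ b
    rises≡ = trans (cong₂ rises (proj₁ (∷-injective labels≡)) (proj₂ (∷-injective labels≡)))
                   (rises-permutation b)

  pf≡schröder : ∀ k → pf (suc k) ρs ≡ schröder (suc k)
  pf≡schröder k = ℕ.≤-antisym
    (length-≤ (λ p m → encode p ≡ m) avoiding!
      (λ {p} p∈ → let pfp , _ = member⁻ p∈ in
        encode p , ∈-markedWords⁺ (encode-marked p pfp) , refl)
      (λ p∈ q∈ eq eq′ → let pfp , avp = member⁻ p∈ ; pfq , avq = member⁻ q∈ in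
        encode-injective pfp pfq avp avq (trans eq (sym eq′))))
    -- In this direction injectivity is immediate, since `p` has only one code, and the content lies
    -- in `decode`.
    (length-≤ (λ m p → encode p ≡ m) (markedWords-unique N 0 (suc k))
      (λ m∈ → let p , pfav , eq = decode (∈-markedWords⁻ N 0 (suc k) m∈) in
        p , member⁺ pfav , eq)
      (λ _ _ eq eq′ → trans (sym eq) eq′))
    where
    avoiding = filter (avoidsAll? ρs ∘ φ) (parkingFunctions (suc k))

    avoiding! : Unique avoiding
    avoiding! = Unique.filter⁺ (avoidsAll? ρs ∘ φ) (parkingFunctions-unique (suc k))

    member⁻ : ∀ {p} → p ∈ avoiding → IsParkingFunction (suc k) p × AvoidsAll ρs (φ p)
    member⁻ {p} p∈ = let p∈′ , av = ∈-filter⁻ (avoidsAll? ρs ∘ φ) p∈ in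
      Equivalence.to (∈-parkingFunctions p) p∈′ , av

    member⁺ : ∀ {p} → IsParkingFunction (suc k) p × AvoidsAll ρs (φ p) → p ∈ avoiding
    member⁺ {p} (pfp , av) =
      ∈-filter⁺ (avoidsAll? ρs ∘ φ) (Equivalence.from (∈-parkingFunctions p) pfp) av

-- The four pairs of patterns and their operations

projˡ-isBand : IsBand {A = Bool} _≡_ (λ x _ → x)
projˡ-isBand = record
  { isSemigroup = record
      { isMagma = record { isEquivalence = isEquivalence ; ∙-cong = λ eq _ → eq }
      ; assoc   = λ _ _ _ → refl }
  ; idem = λ _ → refl }

projʳ-isBand : IsBand {A = Bool} _≡_ (λ _ y → y)
projʳ-isBand = record
  { isSemigroup = record
      { isMagma = record { isEquivalence = isEquivalence ; ∙-cong = λ _ eq → eq }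
      ; assoc   = λ _ _ _ → refl }
  ; idem = λ _ → refl }

avoidsPair : ∀ {ρ σ π} → AvoidsAll (ρ ∷ σ ∷ []) π ⇔ (π Avoids ρ × π Avoids σ)
avoidsPair = mk⇔ (λ { (a ∷ b ∷ []) → a , b }) (λ (a , b) → a ∷ b ∷ [])

-- `Count` expects the pattern that begins with an ascent first; in the pair 213, 231 it comes
-- second.
avoidsPair-swap : ∀ {ρ σ π} → AvoidsAll (σ ∷ ρ ∷ []) π ⇔ (π Avoids ρ × π Avoids σ)
avoidsPair-swap = mk⇔ (λ { (b ∷ a ∷ []) → a , b }) (λ (a , b) → b ∷ a ∷ [])

132! : Unique p132
132! = from-yes (unique? p132)

213! : Unique p213
213! = from-yes (unique? p213)

231! : Unique p231
231! = from-yes (unique? p231)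

312! : Unique p312
312! = from-yes (unique? p312)

-- Size 0 is included because the recurrence reaches it. The closing `refl`s check that the third
-- comparison in each pattern is the negation of the conjunction of the other two.
pf-132-213 : ∀ n → pf n (p132 ∷ p213 ∷ []) ≡ schröder n
pf-132-213 zero    = refl
pf-132-213 (suc k) = Count.pf≡schröder _∧_ ∧-isBand _ 1 3 2 2 1 3
  (λ _ → avoidsPair) 132! 213! refl refl k

pf-132-312 : ∀ k → pf (suc k) (p132 ∷ p312 ∷ []) ≡ schröder (suc k)
pf-132-312 = Count.pf≡schröder (λ _ y → y) projʳ-isBand _ 1 3 2 3 1 2
  (λ _ → avoidsPair) 132! 312! refl refl

pf-213-231 : ∀ k → pf (suc k) (p213 ∷ p231 ∷ []) ≡ schröder (suc k)
pf-213-231 = Count.pf≡schröder (λ x _ → x) projˡ-isBand _ 2 3 1 2 1 3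
  (λ _ → avoidsPair-swap) 231! 213! refl refl

pf-231-312 : ∀ k → pf (suc k) (p231 ∷ p312 ∷ []) ≡ schröder (suc k)
pf-231-312 = Count.pf≡schröder _∨_ ∨-isBand _ 2 3 1 3 1 2
  (λ _ → avoidsPair) 231! 312! refl refl

theorem23 : ((n : ℕ) → 1 ≤ n →
    (pf n (p132 ∷ p213 ∷ []) ≡ pf n (p132 ∷ p312 ∷ []))
    × (pf n (p132 ∷ p312 ∷ []) ≡ pf n (p213 ∷ p231 ∷ []))
    × (pf n (p213 ∷ p231 ∷ []) ≡ pf n (p231 ∷ p312 ∷ [])))
    ×
    ((n : ℕ) → 1 ≤ n →
    pf n (p132 ∷ p213 ∷ [])
    ≡ pf (n ∸ 1) (p132 ∷ p213 ∷ [])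
    + 2 * Σ₁ (n ∸ 1) (λ i →
    pf i (p132 ∷ p213 ∷ []) * pf (n ∸ i ∸ 1) (p132 ∷ p213 ∷ [])))
theorem23 =
  (λ { (suc k) _ →
    trans (pf-132-213 (suc k)) (sym (pf-132-312 k)) ,
    trans (pf-132-312 k) (sym (pf-213-231 k)) ,
    trans (pf-213-231 k) (sym (pf-231-312 k)) }) ,
  λ { (suc k) _ → begin
    pf (suc k) (p132 ∷ p213 ∷ [])
      ≡⟨ pf-132-213 (suc k) ⟩
    schröder (suc k)
      ≡⟨ schröder-recurrence k ⟩
    schröder k + 2 * Σ₁ k (λ i → schröder i * schröder (k ∸ i))
      ≡⟨ cong₂ (λ x xs → x + 2 * sum xs) (sym (pf-132-213 k))
           (map-cong (λ i → sym (cong₂ _*_ (pf-132-213 i) (complement k i))) (applyUpTo suc k)) ⟩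
    pf k (p132 ∷ p213 ∷ []) + 2 * Σ₁ k (λ i →
      pf i (p132 ∷ p213 ∷ []) * pf (suc k ∸ i ∸ 1) (p132 ∷ p213 ∷ [])) ∎ }
  where
  open ≡-Reasoning

  complement : ∀ k i → pf (suc k ∸ i ∸ 1) (p132 ∷ p213 ∷ []) ≡ schröder (k ∸ i)
  -- The index becomes `suc k ∸ (1 + i)`, which computes to `k ∸ i` for every `i`.
  complement k i = trans (pf-132-213 (suc k ∸ i ∸ 1))
    (cong schröder (trans (ℕ.∸-+-assoc (suc k) i 1) (cong (suc k ∸_) (ℕ.+-comm i 1))))
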